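{- Let $\mathbb{F}_q$ be a finite field, let $W$ be a weighing matrix $\mathrm{W}(n,m)$, and let $G=[\,W\mid I_n\,]$ over $\mathbb{F}_q$. If $m+1\neq 0$ in $\mathbb{F}_q$, then $G$ generates an LCD code $C$ of length $2n$ and dimension $n$ over $\mathbb{F}_q$.
   Context: A weighing matrix $\mathrm{W}(n,m)$ is an $n\times n$ matrix $W$ with entries in $\{0,1,-1\}$ such that $WW^{\top}=mI_n$ over $\mathbb{C}$. Entries $0,\pm1$ and integers are interpreted in $\mathbb{F}_q$. A matrix over $\mathbb{F}_q$ generates the linear code spanned by its rows. For a linear code $C\subseteq\mathbb{F}_q^N$, $C^\perp$ is its orthogonal complement under the standard inner product, and $C$ is LCD if $C\cap C^\perp=\{0\}$. -}

module Defs where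

open import Algebra.Bundles using (CommutativeRing; Semiring)
import Algebra.Definitions as AlgebraDefinitions
import Algebra.Definitions.RawMonoid as RawMonoidDefinitions
import Algebra.Properties.CommutativeMonoid.Sum as MonoidSum
import Algebra.Properties.Semiring.Sum as SemiringSum
open import Data.Bool.Base using (if_then_else_)
open import Data.Fin.Base using (Fin)
import Data.Fin.Properties as Fin
open import Data.Integer.Base as ℤ using (ℤ; 0ℤ; 1ℤ; -1ℤ; +_; -[1+_])
import Data.Integer.Properties as ℤ
open import Data.Nat.Base as ℕ using (ℕ; suc)
open import Data.Product.Base using (_×_; _,_; Σ-syntax)
open import Data.Sum.Base using (_⊎_)
open import Data.Vec.Functional using (Vector; _++_; transpose)
import Data.Vec.Functional.Relation.Binary.Equality.Setoid as VectorEquality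
open import Function.Bundles using (Inverse)
open import Level using (Level; _⊔_) renaming (suc to lsuc)
import Relation.Binary.Reasoning.Setoid as SetoidReasoning
open import Relation.Binary.PropositionalEquality using (_≡_)
import Relation.Binary.PropositionalEquality as ≡
open import Relation.Nullary using (¬_; does)
open import Relation.Unary using (Pred; _∈_; _∩_; _≐_)

-- The library's HeytingField carries an apartness relation as extra data; on a
-- finite carrier it is determined by _≈_, so the plain field axioms are used.
record FiniteField (c ℓ : Level) (q : ℕ) : Set (lsuc (c ⊔ ℓ)) where
  field
    commutativeRing : CommutativeRing c ℓ

  open CommutativeRing commutativeRing public
  open AlgebraDefinitions _≈_ using (Invertible)

  field
    1≉0         : ¬ (1# ≈ 0#)
    invertible  : ∀ x → ¬ (x ≈ 0#) → Invertible 1# _*_ x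
    enumeration : Inverse setoid (≡.setoid (Fin q))

Matrix : ∀ {a} → Set a → ℕ → ℕ → Set a
Matrix A r s = Vector (Vector A s) r

infixr 5 _∣∣_

_∣∣_ : ∀ {a} {A : Set a} {r s t} → Matrix A r s → Matrix A r t → Matrix A r (s ℕ.+ t)
(M ∣∣ N) i = M i ++ N i

mapMatrix : ∀ {a b} {A : Set a} {B : Set b} {r s} → (A → B) → Matrix A r s → Matrix B r s
mapMatrix f M i j = f (M i j)

module Matrices {c ℓ} (R : CommutativeRing c ℓ) where
  open CommutativeRing R
  open RawMonoidDefinitions +-rawMonoid using (sum)

  infixl 7 _⊗_
  infixr 7 _⊙_
  infix 4 _≈ᴹ_

  _≈ᴹ_ : ∀ {r s} → Matrix Carrier r s → Matrix Carrier r s → Set ℓ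
  M ≈ᴹ N = ∀ i j → M i j ≈ N i j

  _⊗_ : ∀ {r s t} → Matrix Carrier r s → Matrix Carrier s t → Matrix Carrier r t
  (M ⊗ N) i j = sum (λ k → M i k * N k j)

  _⊙_ : ∀ {r s} → Carrier → Matrix Carrier r s → Matrix Carrier r s
  (x ⊙ M) i j = x * M i j

  identity : ∀ n → Matrix Carrier n n
  identity n i j = if does (i Fin.≟ j) then 1# else 0#

-- The entries are integers, so W Wᵀ = m I over ℂ is this identity over ℤ ⊆ ℂ.
record IsWeighingMatrix (n m : ℕ) (W : Matrix ℤ n n) : Set where
  open Matrices ℤ.+-*-commutativeRing
  field
    entries : ∀ i j → W i j ≡ 0ℤ ⊎ W i j ≡ 1ℤ ⊎ W i j ≡ -1ℤ
    gram    : W ⊗ transpose W ≈ᴹ (+ m) ⊙ identity n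

module LinearCodes {c ℓ q} (F : FiniteField c ℓ q) where
  open FiniteField F
  open RawMonoidDefinitions +-rawMonoid using (sum) renaming (_×_ to _·_)
  open VectorEquality setoid using (_≋_; ≋-refl; ≋-sym; ≋-trans)
  open MonoidSum +-commutativeMonoid using (sum-cong-≋; sum-replicate-zero; ∑-distrib-+)
  open SemiringSum semiring using (*-distribˡ-sum)
  open SetoidReasoning setoid

  -- The canonical ring homomorphism ℤ → F.
  fromℤ : ℤ → Carrier
  fromℤ (+ k)    = k · 1#
  fromℤ -[1+ k ] = - (suc k · 1#)

  0ᵛ : ∀ {N} → Vector Carrier N
  0ᵛ _ = 0#

  infixl 6 _+ᵛ_
  _+ᵛ_ : ∀ {N} → Vector Carrier N → Vector Carrier N → Vector Carrier N
  (v +ᵛ w) j = v j + w j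

  infixr 7 _*ᵛ_
  _*ᵛ_ : ∀ {N} → Carrier → Vector Carrier N → Vector Carrier N
  (x *ᵛ v) j = x * v j

  ⟨_,_⟩ : ∀ {N} → Vector Carrier N → Vector Carrier N → Carrier
  ⟨ v , w ⟩ = sum (λ j → v j * w j)

  -- The linear combination ∑ᵢ uᵢ bᵢ, i.e. the row vector u times the matrix b.
  combination : ∀ {k N} → Vector Carrier k → Matrix Carrier k N → Vector Carrier N
  combination u b j = sum (λ i → u i * b i j)

  record LinearCode (N : ℕ) : Set (lsuc (c ⊔ ℓ)) where
    field
      codewords : Pred (Vector Carrier N) (c ⊔ ℓ)
      resp      : ∀ {v w} → v ≋ w → v ∈ codewords → w ∈ codewords
      zero∈     : 0ᵛ ∈ codewords
      +-closed  : ∀ {v w} → v ∈ codewords → w ∈ codewords → v +ᵛ w ∈ codewords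
      *-closed  : ∀ x {v} → v ∈ codewords → x *ᵛ v ∈ codewords

  open LinearCode public

  private
    sum-zero : ∀ {k} {f : Vector Carrier k} → (∀ i → f i ≈ 0#) → sum f ≈ 0#
    sum-zero {k} f≈0 = trans (sum-cong-≋ f≈0) (sum-replicate-zero k)

    sum-plus : ∀ {k} {f : Vector Carrier k} (g h : Vector Carrier k) →
               (∀ i → f i ≈ g i + h i) → sum f ≈ sum g + sum h
    sum-plus g h f≈g+h = trans (sum-cong-≋ f≈g+h) (∑-distrib-+ g h)

    sum-scale : ∀ {k} {f : Vector Carrier k} x (g : Vector Carrier k) →
                (∀ i → f i ≈ x * g i) → sum f ≈ x * sum g
    sum-scale x g f≈xg = trans (sum-cong-≋ f≈xg) (sym (*-distribˡ-sum x g))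

  generatedBy : ∀ {k N} → Matrix Carrier k N → LinearCode N
  generatedBy {k} G = record
    { codewords = λ v → Σ[ u ∈ Vector Carrier k ] v ≋ combination u G
    ; resp      = λ v≋w (u , v≋uG) → u , ≋-trans (≋-sym v≋w) v≋uG
    ; zero∈     = 0ᵛ , λ j → sym (sum-zero (λ i → zeroˡ (G i j)))
    ; +-closed  = λ (u , v≋uG) (u′ , w≋u′G) → u +ᵛ u′ , λ j →
        trans (+-cong (v≋uG j) (w≋u′G j))
              (sym (sum-plus (λ i → u i * G i j) (λ i → u′ i * G i j)
                             (λ i → distribʳ (G i j) (u i) (u′ i))))
    ; *-closed  = λ x (u , v≋uG) → x *ᵛ u , λ j →
        trans (*-congˡ (v≋uG j))
              (sym (sum-scale x (λ i → u i * G i j) (λ i → *-assoc x (u i) (G i j))))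
    }

  infix 10 _^⊥

  _^⊥ : ∀ {N} → LinearCode N → LinearCode N
  C ^⊥ = record
    { codewords = λ v → ∀ w → w ∈ codewords C → ⟨ v , w ⟩ ≈ 0#
    ; resp      = λ v≋v′ v⊥ w w∈C →
        trans (sum-cong-≋ (λ j → *-congʳ (sym (v≋v′ j)))) (v⊥ w w∈C)
    ; zero∈     = λ w _ → sum-zero (λ j → zeroˡ (w j))
    ; +-closed  = λ {v} {v′} v⊥ v′⊥ w w∈C →
        trans (sum-plus (λ j → v j * w j) (λ j → v′ j * w j)
                        (λ j → distribʳ (w j) (v j) (v′ j)))
              (trans (+-cong (v⊥ w w∈C) (v′⊥ w w∈C)) (+-identityˡ 0#))
    ; *-closed  = λ x {v} v⊥ w w∈C →
        trans (sum-scale x (λ j → v j * w j) (λ j → *-assoc x (v j) (w j)))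
              (trans (*-congˡ (v⊥ w w∈C)) (zeroʳ x))
    }

  IsLCD : ∀ {N} → LinearCode N → Set (c ⊔ ℓ)
  IsLCD C = (codewords C ∩ codewords (C ^⊥)) ≐ (_≋ 0ᵛ)

  record IsBasis {k N} (C : LinearCode N) (b : Matrix Carrier k N) : Set (c ⊔ ℓ) where
    field
      members     : ∀ i → b i ∈ codewords C
      independent : ∀ u → combination u b ≋ 0ᵛ → u ≋ 0ᵛ
      spanning    : ∀ v → v ∈ codewords C → Σ[ u ∈ Vector Carrier k ] v ≋ combination u b

  HasDimension : ∀ {N} → LinearCode N → ℕ → Set (c ⊔ ℓ)
  HasDimension {N} C k = Σ[ b ∈ Matrix Carrier k N ] IsBasis C b

{-# OPTIONS --safe #-}

-- Over ℤ, W Wᵀ = m I, so over the field G Gᵀ = W Wᵀ + I = (m + 1) I. If v = u G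
-- is orthogonal to every row of G, then 0 = u G Gᵀ = (m + 1) u, and u = 0 because
-- m + 1 is a unit. Hence C ∩ C^⊥ = 0, and the rows of G are linearly independent.

module Submission where

open import Defs
open import Data.Nat.Base as ℕ using (ℕ)
open import Data.Integer.Base as ℤ using (ℤ; +_; 1ℤ)
open import Data.Product.Base using (_×_)
open import Relation.Nullary using (¬_)

open import Algebra.Bundles using (CommutativeRing)
import Algebra.Definitions.RawMonoid as RawMonoidDefinitions
import Algebra.Properties.Ring as RingProperties
import Algebra.Properties.Semiring.Mult as SemiringMult
import Algebra.Properties.Semiring.Sum as SemiringSum
open import Data.Fin.Base using (zero; suc; _↑ˡ_; _↑ʳ_)
open import Data.Integer.Base using (-[1+_]; _⊖_)
import Data.Integer.Properties as ℤ
open import Data.Product.Base using (_,_)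
open import Data.Vec.Functional using (Vector; transpose)
open import Data.Vec.Functional.Properties using (lookup-++ˡ; lookup-++ʳ)
import Data.Vec.Functional.Relation.Binary.Equality.Setoid as VectorEquality
open import Function.Base using (_∘_)
import Relation.Binary.PropositionalEquality as ≡
import Relation.Binary.Reasoning.Setoid as SetoidReasoning

-- Finite sums, the identity matrix and Gram matrices over a commutative ring.

module MatrixProperties {c ℓ} (R : CommutativeRing c ℓ) where
  open CommutativeRing R hiding (zero)
  open Matrices R
  open SemiringSum semiring using (sum; sum-cong-≋; sum-replicate-zero)
  open SetoidReasoning setoid

  sum-split : ∀ r {s} (f : Vector Carrier (r ℕ.+ s)) →
              sum f ≈ sum (λ i → f (i ↑ˡ s)) + sum (λ i → f (r ↑ʳ i))
  sum-split ℕ.zero    f = sym (+-identityˡ (sum f))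
  sum-split (ℕ.suc r) f =
    trans (+-congˡ (sum-split r (f ∘ suc))) (sym (+-assoc _ _ _))

  identity-symmetric : ∀ n i j → identity n i j ≈ identity n j i
  identity-symmetric (ℕ.suc n) zero    zero    = refl
  identity-symmetric (ℕ.suc n) zero    (suc j) = refl
  identity-symmetric (ℕ.suc n) (suc i) zero    = refl
  identity-symmetric (ℕ.suc n) (suc i) (suc j) = identity-symmetric n i j

  sum-identityˡ : ∀ {n} (v : Vector Carrier n) i →
                  sum (λ j → identity n i j * v j) ≈ v i
  sum-identityˡ {ℕ.suc n} v zero = begin
    1# * v zero + sum (λ j → 0# * v (suc j))
      ≈⟨ +-cong (*-identityˡ _) (sum-cong-≋ (λ j → zeroˡ (v (suc j)))) ⟩
    v zero + sum {n} (λ _ → 0#)  ≈⟨ +-congˡ (sum-replicate-zero n) ⟩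
    v zero + 0#                  ≈⟨ +-identityʳ _ ⟩
    v zero                       ∎
  sum-identityˡ {ℕ.suc n} v (suc i) =
    trans (+-cong (zeroˡ _) (sum-identityˡ (v ∘ suc) i)) (+-identityˡ _)

  sum-identityʳ : ∀ {n} (v : Vector Carrier n) i →
                  sum (λ j → v j * identity n j i) ≈ v i
  sum-identityʳ {n} v i = trans
    (sum-cong-≋ (λ j → trans (*-comm _ _) (*-congʳ (identity-symmetric n j i))))
    (sum-identityˡ v i)

  identity-gram : ∀ n → identity n ⊗ transpose (identity n) ≈ᴹ identity n
  identity-gram n i j =
    trans (sum-identityˡ (identity n j) i) (identity-symmetric n j i)

  -- The sum over the columns is cut after the first `s` indices; columns of the left block only
  -- meet columns of the left block, and likewise on the right, so there are no cross terms.
  ∣∣-gram : ∀ {r s t} (M : Matrix Carrier r s) (N : Matrix Carrier r t) i j →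
            ((M ∣∣ N) ⊗ transpose (M ∣∣ N)) i j ≈
            (M ⊗ transpose M) i j + (N ⊗ transpose N) i j
  ∣∣-gram {s = s} M N i j = trans (sum-split s _) (+-cong
    (sum-cong-≋ (λ k → reflexive
      (≡.cong₂ _*_ (lookup-++ˡ (M i) (N i) k) (lookup-++ˡ (M j) (N j) k))))
    (sum-cong-≋ (λ k → reflexive
      (≡.cong₂ _*_ (lookup-++ʳ (M i) (N i) k) (lookup-++ʳ (M j) (N j) k)))))

module CodeProperties {c ℓ q} (F : FiniteField c ℓ q) where
  open FiniteField F hiding (zero)
  open Matrices commutativeRing
  open MatrixProperties commutativeRing
  open LinearCodes F
  open RingProperties ring
    using (-0#≈0#; -‿involutive; -‿+-comm; -‿distribˡ-*; -‿distribʳ-*)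
  open SemiringMult semiring using (×-homo-+; ×1-homo-*) renaming (_×_ to _·_)
  open SemiringSum semiring
    using (sum; sum-cong-≋; sum-replicate-zero; ∑-comm; *-distribˡ-sum; *-distribʳ-sum)
  open VectorEquality setoid using (_≋_; ≋-sym; ≋-trans)
  open RawMonoidDefinitions ℤ.+-0-rawMonoid using () renaming (sum to sumℤ)
  open SetoidReasoning setoid

  -- The canonical map from the integers to the field is a ring homomorphism.

  fromℤ-⊖ : ∀ a b → fromℤ (a ⊖ b) ≈ a · 1# - b · 1#
  fromℤ-⊖ a         ℕ.zero    = sym (trans (+-congˡ -0#≈0#) (+-identityʳ _))
  fromℤ-⊖ ℕ.zero    (ℕ.suc b) = sym (+-identityˡ _)
  fromℤ-⊖ (ℕ.suc a) (ℕ.suc b) = begin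
    fromℤ (ℕ.suc a ⊖ ℕ.suc b)            ≡⟨ ≡.cong fromℤ (ℤ.[1+m]⊖[1+n]≡m⊖n a b) ⟩
    fromℤ (a ⊖ b)                        ≈⟨ fromℤ-⊖ a b ⟩
    x - y                                ≈⟨ +-congʳ (+-identityʳ x) ⟨
    -- Cancelling a successor on both sides of `⊖` is undone in the field: the inserted `1# - 1#`
    -- gives one unit to each of the two multiples.
    x + 0# - y                           ≈⟨ +-congʳ (+-congˡ (-‿inverseʳ 1#)) ⟨
    x + (1# - 1#) - y                    ≈⟨ +-congʳ (+-assoc x 1# (- 1#)) ⟨
    x + 1# - 1# - y                      ≈⟨ +-assoc _ _ _ ⟩
    x + 1# + (- 1# - y)                  ≈⟨ +-cong (+-comm x 1#) (-‿+-comm 1# y) ⟩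
    ℕ.suc a · 1# - ℕ.suc b · 1#          ∎
    where
    x = a · 1#
    y = b · 1#

  -- Integer addition with mixed signs computes to `⊖`, which `fromℤ-⊖` handles; equal signs reduce
  -- to additivity of natural multiples of `1#`.
  fromℤ-+ : ∀ x y → fromℤ (x ℤ.+ y) ≈ fromℤ x + fromℤ y
  fromℤ-+ (+ a)    (+ b)    = ×-homo-+ 1# a b
  fromℤ-+ (+ a)    -[1+ b ] = fromℤ-⊖ a (ℕ.suc b)
  fromℤ-+ -[1+ a ] (+ b)    = trans (fromℤ-⊖ b (ℕ.suc a)) (+-comm _ _)
  fromℤ-+ -[1+ a ] -[1+ b ] = begin
    -- The sum computes to `-[1+ suc (a + b) ]`; writing it as the negative of a sum of two
    -- successors makes `×-homo-+` applicable.
    fromℤ (-[1+ a ] ℤ.+ -[1+ b ])          ≡⟨ ≡.cong fromℤ (ℤ.neg-distrib-+ (+ ℕ.suc a) (+ ℕ.suc b)) ⟨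
    - ((ℕ.suc a ℕ.+ ℕ.suc b) · 1#)         ≈⟨ -‿cong (×-homo-+ 1# (ℕ.suc a) (ℕ.suc b)) ⟩
    - (ℕ.suc a · 1# + ℕ.suc b · 1#)        ≈⟨ -‿+-comm _ _ ⟨
    - (ℕ.suc a · 1#) - ℕ.suc b · 1#        ∎

  fromℤ-neg : ∀ x → fromℤ (ℤ.- x) ≈ - fromℤ x
  fromℤ-neg (+ ℕ.zero)    = sym -0#≈0#
  fromℤ-neg (+ (ℕ.suc a)) = refl
  fromℤ-neg -[1+ a ]      = sym (-‿involutive _)

  fromℤ-+*+ : ∀ a b → fromℤ (+ a ℤ.* + b) ≈ fromℤ (+ a) * fromℤ (+ b)
  fromℤ-+*+ a b = trans (reflexive (≡.cong fromℤ (≡.sym (ℤ.pos-* a b)))) (×1-homo-* a b)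

  fromℤ-+* : ∀ a y → fromℤ (+ a ℤ.* y) ≈ fromℤ (+ a) * fromℤ y
  fromℤ-+* a (+ b)    = fromℤ-+*+ a b
  fromℤ-+* a -[1+ b ] = begin
    fromℤ (+ a ℤ.* -[1+ b ])          ≡⟨ ≡.cong fromℤ (ℤ.neg-distribʳ-* (+ a) (+ ℕ.suc b)) ⟨
    fromℤ (ℤ.- (+ a ℤ.* + ℕ.suc b))   ≈⟨ fromℤ-neg (+ a ℤ.* + ℕ.suc b) ⟩
    - fromℤ (+ a ℤ.* + ℕ.suc b)       ≈⟨ -‿cong (fromℤ-+*+ a (ℕ.suc b)) ⟩
    - (fromℤ (+ a) * (ℕ.suc b · 1#))  ≈⟨ -‿distribʳ-* _ _ ⟩
    fromℤ (+ a) * fromℤ -[1+ b ]      ∎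

  -- Signs are pulled out one factor at a time, the right factor in `fromℤ-+*` and the left one
  -- here, which leaves a product of natural multiples of `1#`.
  fromℤ-* : ∀ x y → fromℤ (x ℤ.* y) ≈ fromℤ x * fromℤ y
  fromℤ-* (+ a)    y = fromℤ-+* a y
  fromℤ-* -[1+ a ] y = begin
    fromℤ (-[1+ a ] ℤ.* y)          ≡⟨ ≡.cong fromℤ (ℤ.neg-distribˡ-* (+ ℕ.suc a) y) ⟨
    fromℤ (ℤ.- (+ ℕ.suc a ℤ.* y))   ≈⟨ fromℤ-neg (+ ℕ.suc a ℤ.* y) ⟩
    - fromℤ (+ ℕ.suc a ℤ.* y)       ≈⟨ -‿cong (fromℤ-+* (ℕ.suc a) y) ⟩
    - (ℕ.suc a · 1# * fromℤ y)      ≈⟨ -‿distribˡ-* _ _ ⟩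
    fromℤ -[1+ a ] * fromℤ y        ∎

  fromℤ-sum : ∀ {k} (f : Vector ℤ k) → fromℤ (sumℤ f) ≈ sum (fromℤ ∘ f)
  fromℤ-sum {ℕ.zero}  f = refl
  fromℤ-sum {ℕ.suc k} f =
    trans (fromℤ-+ (f zero) (sumℤ (f ∘ suc))) (+-congˡ (fromℤ-sum (f ∘ suc)))

  fromℤ-identity : ∀ n i j →
                   fromℤ (Matrices.identity ℤ.+-*-commutativeRing n i j) ≈ identity n i j
  -- The image of the integer one unfolds to `1# + 0#`, so this case is not `refl`.
  fromℤ-identity (ℕ.suc n) zero    zero    = +-identityʳ 1#
  fromℤ-identity (ℕ.suc n) zero    (suc j) = refl
  fromℤ-identity (ℕ.suc n) (suc i) zero    = refl
  fromℤ-identity (ℕ.suc n) (suc i) (suc j) = fromℤ-identity n i j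

  -- The Gram matrix of the generator matrix over the field.

  mapMatrix-fromℤ-gram : ∀ {n m W} → IsWeighingMatrix n m W →
    mapMatrix fromℤ W ⊗ transpose (mapMatrix fromℤ W) ≈ᴹ fromℤ (+ m) ⊙ identity n
  mapMatrix-fromℤ-gram {n} {m} {W} isWeighing i j = begin
    -- The homomorphism laws are read backwards to gather the sum under a single `fromℤ`, where the
    -- integer identity for the weighing matrix applies.
    sum (λ k → fromℤ (W i k) * fromℤ (W j k))  ≈⟨ sum-cong-≋ (λ k → fromℤ-* (W i k) (W j k)) ⟨
    sum (λ k → fromℤ (W i k ℤ.* W j k))        ≈⟨ fromℤ-sum (λ k → W i k ℤ.* W j k) ⟨
    fromℤ (sumℤ (λ k → W i k ℤ.* W j k))       ≡⟨ ≡.cong fromℤ (IsWeighingMatrix.gram isWeighing i j) ⟩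
    fromℤ (+ m ℤ.* Iᵢⱼ)                        ≈⟨ fromℤ-* (+ m) Iᵢⱼ ⟩
    fromℤ (+ m) * fromℤ Iᵢⱼ                    ≈⟨ *-congˡ (fromℤ-identity n i j) ⟩
    fromℤ (+ m) * identity n i j               ∎
    where Iᵢⱼ = Matrices.identity ℤ.+-*-commutativeRing n i j

  [W∣I]-gram : ∀ {n m W} → IsWeighingMatrix n m W →
    let G = mapMatrix fromℤ W ∣∣ identity n in
    G ⊗ transpose G ≈ᴹ fromℤ (+ m ℤ.+ 1ℤ) ⊙ identity n
  [W∣I]-gram {n} {m} {W} isWeighing i j = begin
    (G ⊗ transpose G) i j                              ≈⟨ ∣∣-gram Wᶠ (identity n) i j ⟩
    (Wᶠ ⊗ transpose Wᶠ) i j + (identity n ⊗ transpose (identity n)) i j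
      ≈⟨ +-cong (mapMatrix-fromℤ-gram isWeighing i j) (identity-gram n i j) ⟩
    fromℤ (+ m) * identity n i j + identity n i j      ≈⟨ +-congˡ (*-identityˡ _) ⟨
    fromℤ (+ m) * identity n i j + 1# * identity n i j ≈⟨ distribʳ _ _ _ ⟨
    -- The unit contributed by the identity block becomes `fromℤ 1ℤ`, so that the scalar is the
    -- image of the integer m + 1 that is assumed nonzero.
    (fromℤ (+ m) + 1#) * identity n i j                ≈⟨ *-congʳ (+-congˡ (+-identityʳ 1#)) ⟨
    (fromℤ (+ m) + fromℤ 1ℤ) * identity n i j          ≈⟨ *-congʳ (fromℤ-+ (+ m) 1ℤ) ⟨
    fromℤ (+ m ℤ.+ 1ℤ) * identity n i j                ∎
    where
    Wᶠ = mapMatrix fromℤ W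
    G  = Wᶠ ∣∣ identity n

  -- Inner products, combinations of rows and cancellation.

  ⟨⟩-congʳ : ∀ {N} {v v′ : Vector Carrier N} w → v ≋ v′ → ⟨ v , w ⟩ ≈ ⟨ v′ , w ⟩
  ⟨⟩-congʳ w v≋v′ = sum-cong-≋ (λ j → *-congʳ (v≋v′ j))

  ⟨0,w⟩≈0 : ∀ {N} (w : Vector Carrier N) → ⟨ 0ᵛ , w ⟩ ≈ 0#
  ⟨0,w⟩≈0 {N} w = trans (sum-cong-≋ (λ j → zeroˡ (w j))) (sum-replicate-zero N)

  -- Linearity in the first argument, obtained by exchanging the sum over columns with the sum over
  -- rows.
  ⟨combination,w⟩ : ∀ {k N} (u : Vector Carrier k) (G : Matrix Carrier k N) w →
                    ⟨ combination u G , w ⟩ ≈ sum (λ i → u i * ⟨ G i , w ⟩)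
  ⟨combination,w⟩ u G w = begin
    sum (λ j → sum (λ i → u i * G i j) * w j)
      ≈⟨ sum-cong-≋ (λ j → *-distribʳ-sum (w j) (λ i → u i * G i j)) ⟩
    sum (λ j → sum (λ i → u i * G i j * w j))
      ≈⟨ ∑-comm (λ j i → u i * G i j * w j) ⟩
    sum (λ i → sum (λ j → u i * G i j * w j))
      ≈⟨ sum-cong-≋ (λ i → sum-cong-≋ (λ j → *-assoc (u i) (G i j) (w j))) ⟩
    sum (λ i → sum (λ j → u i * (G i j * w j)))
      ≈⟨ sum-cong-≋ (λ i → *-distribˡ-sum (u i) (λ j → G i j * w j)) ⟨
    sum (λ i → u i * ⟨ G i , w ⟩)
      ∎

  combination-zeroˡ : ∀ {k N} {u : Vector Carrier k} (G : Matrix Carrier k N) →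
                      u ≋ 0ᵛ → combination u G ≋ 0ᵛ
  combination-zeroˡ {k} G u≋0 j =
    trans (sum-cong-≋ (λ i → trans (*-congʳ (u≋0 i)) (zeroˡ (G i j)))) (sum-replicate-zero k)

  row∈generatedBy : ∀ {k N} (G : Matrix Carrier k N) i → codewords (generatedBy G) (G i)
  -- The coefficients are those of the unit vector at `i`.
  row∈generatedBy {k} G i = identity k i , λ j → sym (sum-identityˡ (λ l → G l j) i)

  *-cancel-nonzeroˡ : ∀ {x y} → ¬ (x ≈ 0#) → x * y ≈ 0# → y ≈ 0#
  *-cancel-nonzeroˡ {x} {y} x≉0 xy≈0 with invertible x x≉0
  ... | x⁻¹ , x⁻¹x≈1 , _ = begin
    y              ≈⟨ *-identityˡ y ⟨
    1# * y         ≈⟨ *-congʳ x⁻¹x≈1 ⟨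
    x⁻¹ * x * y    ≈⟨ *-assoc x⁻¹ x y ⟩
    x⁻¹ * (x * y)  ≈⟨ *-congˡ xy≈0 ⟩
    x⁻¹ * 0#       ≈⟨ zeroʳ x⁻¹ ⟩
    0#             ∎

  -- Codes generated by a matrix whose Gram matrix is a nonzero scalar matrix.

  module ScalarGram {k N μ} (G : Matrix Carrier k N)
                    (gram : G ⊗ transpose G ≈ᴹ μ ⊙ identity k)
                    (μ≉0 : ¬ (μ ≈ 0#)) where

    -- This is entry `i` of u G Gᵀ = u (μ I): the inner product of two rows is by definition an
    -- entry of the Gram matrix.
    ⟨combination,row⟩ : ∀ u i → ⟨ combination u G , G i ⟩ ≈ μ * u i
    ⟨combination,row⟩ u i = begin
      ⟨ combination u G , G i ⟩             ≈⟨ ⟨combination,w⟩ u G (G i) ⟩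
      sum (λ l → u l * ⟨ G l , G i ⟩)       ≈⟨ sum-cong-≋ (λ l → trans (*-congˡ (gram l i)) (swap l)) ⟩
      sum (λ l → μ * (u l * identity k l i)) ≈⟨ *-distribˡ-sum μ (λ l → u l * identity k l i) ⟨
      μ * sum (λ l → u l * identity k l i)  ≈⟨ *-congˡ (sum-identityʳ u i) ⟩
      μ * u i                               ∎
      where
      swap : ∀ l → u l * (μ * identity k l i) ≈ μ * (u l * identity k l i)
      swap l = trans (sym (*-assoc _ _ _)) (trans (*-congʳ (*-comm (u l) μ)) (*-assoc _ _ _))

    -- The common core of the LCD property and of linear independence: orthogonality to row `i` says
    -- that `μ * u i` is zero, and `μ` is cancelled.
    coefficients-vanish : ∀ u → (∀ i → ⟨ combination u G , G i ⟩ ≈ 0#) → u ≋ 0ᵛ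
    coefficients-vanish u uG⊥G i =
      *-cancel-nonzeroˡ μ≉0 (trans (sym (⟨combination,row⟩ u i)) (uG⊥G i))

    isLCD : IsLCD (generatedBy G)
    -- `_≐_` asks for two inclusions; for the second, membership of `0ᵛ` in both codes is
    -- transported along `v ≋ 0ᵛ`.
    isLCD = trivial , λ {v} v≋0 →
      resp C (≋-sym v≋0) (zero∈ C) , resp (C ^⊥) {0ᵛ} {v} (≋-sym v≋0) (zero∈ (C ^⊥))
      where
      C = generatedBy G

      trivial : ∀ {v} → codewords C v × codewords (C ^⊥) v → v ≋ 0ᵛ
      -- A codeword of the dual is in particular orthogonal to each row, since rows are codewords;
      -- hence its coefficients vanish, and so does the codeword.
      trivial ((u , v≋uG) , v⊥C) = ≋-trans v≋uG (combination-zeroˡ G (coefficients-vanish u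
        (λ i → trans (⟨⟩-congʳ (G i) (≋-sym v≋uG)) (v⊥C (G i) (row∈generatedBy G i)))))

    hasDimension : HasDimension (generatedBy G) k
    hasDimension = G , record
      { members     = row∈generatedBy G
      -- A vanishing combination is orthogonal to every row.
      ; independent = λ u uG≋0 → coefficients-vanish u
          (λ i → trans (⟨⟩-congʳ (G i) uG≋0) (⟨0,w⟩≈0 (G i)))
      -- Membership in `generatedBy G` is by definition the existence of such coefficients.
      ; spanning    = λ v v∈C → v∈C
      }

theorem3p8 : ∀ {c ℓ} (q : ℕ) (F : FiniteField c ℓ q) (n m : ℕ) (W : Matrix ℤ n n) →
    let open FiniteField F in
    let open Matrices commutativeRing using (identity) in
    let open LinearCodes F in
    IsWeighingMatrix n m W →
    ¬ (fromℤ (+ m ℤ.+ 1ℤ) ≈ 0#) →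
    let G = mapMatrix fromℤ W ∣∣ identity n in
    let C = generatedBy G in
    IsLCD {n ℕ.+ n} C × HasDimension {n ℕ.+ n} C n
theorem3p8 q F n m W isWeighing m+1≉0 = isLCD , hasDimension
  where
  open Matrices (FiniteField.commutativeRing F) using (identity)
  open LinearCodes F using (fromℤ)
  open CodeProperties F
  open ScalarGram (mapMatrix fromℤ W ∣∣ identity n) ([W∣I]-gram isWeighing) m+1≉0
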